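{- Let $n\ge 1$ and let $B$ be a nondegenerate complex quadratic form in $n$ variables $z_1,\dots,z_n$. Then the point $O=\left(\frac{2}{n},\dots,\frac{2}{n}\right)\in\mathbb{R}^n$ belongs to the Newton polytope $N(B)$.
   Context: For a polynomial $p=\sum_{k} a_k z_1^{k_1}\cdots z_n^{k_n}\in\mathbb{C}[z_1,\dots,z_n]$, its Newton polytope is $N(p)=\operatorname{conv}\{k\in\mathbb{Z}^n \mid a_k\neq 0\}\subset\mathbb{R}^n$. A quadratic form $B=\sum_{i,j} B_{ij}z_iz_j$ with symmetric matrix $(B_{ij})$ is nondegenerate if $\det(B_{ij})\neq 0$. -}

module Defs where

open import Algebra.Bundles.Raw using (RawRing)
import Algebra.Definitions.RawSemiring as RawSemiringDefinitions
open import Data.Bool.Base using (if_then_else_)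
open import Data.Fin.Base using (Fin; zero; suc; toℕ)
import Data.Integer.Base as ℤ
open import Data.List.Base using (List; []; _∷_; map; allFin; cartesianProduct)
open import Data.Nat.Base as ℕ using (ℕ; zero; suc)
import Data.Nat.Properties as ℕ
open import Data.Product.Base using (∃-syntax; Σ-syntax; _×_; _,_)
open import Data.Rational.Base as ℚ using (ℚ; 0ℚ; 1ℚ; ½; ∣_∣)
import Data.Rational.Properties as ℚ
open import Data.Rational.Solver using (module +-*-Solver)
open import Data.Sum.Base using (_⊎_)
open import Data.Vec.Base as Vec using (Vec)
import Data.Vec.Properties as Vec
open import Data.Vec.Functional using (Vector; removeAt)
open import Level using (0ℓ)
open import Relation.Binary.Core using (Rel)
open import Relation.Binary.PropositionalEquality
  using (_≡_; refl; sym; trans; cong; subst)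
open import Relation.Nullary.Decidable using (does)
open import Relation.Unary using (Pred; _∈_)

------------------------------------------------------------------------
-- Real numbers: Cauchy sequences of rationals, with the usual
-- equivalence, order and apartness

Eventually : Pred ℕ 0ℓ → Set
Eventually P = ∃[ N ] (∀ n → N ℕ.≤ n → P n)

IsCauchy : (ℕ → ℚ) → Set
IsCauchy x = ∀ ε → 0ℚ ℚ.< ε →
  ∃[ N ] (∀ m n → N ℕ.≤ m → N ℕ.≤ n → ∣ x m ℚ.- x n ∣ ℚ.< ε)

record ℝ : Set where
  constructor mkℝ
  field
    seq    : ℕ → ℚ
    cauchy : IsCauchy seq

open ℝ public

infix 4 _≈ᴿ_ _≤ᴿ_ _#ᴿ_

_≈ᴿ_ : Rel ℝ 0ℓ
x ≈ᴿ y = ∀ ε → 0ℚ ℚ.< ε → Eventually (λ n → ∣ seq x n ℚ.- seq y n ∣ ℚ.< ε)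

_≤ᴿ_ : Rel ℝ 0ℓ
x ≤ᴿ y = ∀ ε → 0ℚ ℚ.< ε → Eventually (λ n → seq x n ℚ.< seq y n ℚ.+ ε)

-- Apartness, the positive form of x ≠ y. Classically x #ᴿ y is
-- equivalent to ¬ (x ≈ᴿ y).
_#ᴿ_ : Rel ℝ 0ℓ
x #ᴿ y = ∃[ ε ] (0ℚ ℚ.< ε × Eventually (λ n → ε ℚ.< ∣ seq x n ℚ.- seq y n ∣))

private
  half-pos : ∀ {ε} → 0ℚ ℚ.< ε → 0ℚ ℚ.< ½ ℚ.* ε
  half-pos {ε} 0<ε =
    subst (ℚ._< ½ ℚ.* ε) (ℚ.*-zeroʳ ½) (ℚ.*-monoʳ-<-pos ½ 0<ε)

  half+half : ∀ ε → ½ ℚ.* ε ℚ.+ ½ ℚ.* ε ≡ ε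
  half+half ε = trans (sym (ℚ.*-distribʳ-+ ε ½ ½)) (ℚ.*-identityˡ ε)

  const-cauchy : ∀ q → IsCauchy (λ _ → q)
  const-cauchy q ε 0<ε =
    0 , λ _ _ _ _ → subst (ℚ._< ε) (sym (cong ∣_∣ (ℚ.+-inverseʳ q))) 0<ε

  +-cauchy : ∀ x y → IsCauchy x → IsCauchy y → IsCauchy (λ n → x n ℚ.+ y n)
  +-cauchy x y cx cy ε 0<ε
    with cx (½ ℚ.* ε) (half-pos 0<ε) | cy (½ ℚ.* ε) (half-pos 0<ε)
  ... | M , hx | N , hy = M ℕ.⊔ N , λ m n m≥ n≥ → begin-strict
      ∣ (x m ℚ.+ y m) ℚ.- (x n ℚ.+ y n) ∣    ≡⟨ cong ∣_∣ (rearrange (x m) (y m) (x n) (y n)) ⟩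
      ∣ (x m ℚ.- x n) ℚ.+ (y m ℚ.- y n) ∣    ≤⟨ ℚ.∣p+q∣≤∣p∣+∣q∣ (x m ℚ.- x n) (y m ℚ.- y n) ⟩
      ∣ x m ℚ.- x n ∣ ℚ.+ ∣ y m ℚ.- y n ∣    <⟨ ℚ.+-mono-<
                                                 (hx m n (ℕ.m⊔n≤o⇒m≤o M N m≥) (ℕ.m⊔n≤o⇒m≤o M N n≥))
                                                 (hy m n (ℕ.m⊔n≤o⇒n≤o M N m≥) (ℕ.m⊔n≤o⇒n≤o M N n≥)) ⟩
      ½ ℚ.* ε ℚ.+ ½ ℚ.* ε                    ≡⟨ half+half ε ⟩
      ε                                      ∎
    where
    open ℚ.≤-Reasoning
    open +-*-Solver
    rearrange : ∀ a b c d → (a ℚ.+ b) ℚ.- (c ℚ.+ d) ≡ (a ℚ.- c) ℚ.+ (b ℚ.- d)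
    rearrange = solve 4 (λ a b c d → (a :+ b) :- (c :+ d) := (a :- c) :+ (b :- d)) refl

  neg-cauchy : ∀ x → IsCauchy x → IsCauchy (λ n → ℚ.- x n)
  neg-cauchy x cx ε 0<ε with cx ε 0<ε
  ... | N , hx = N , λ m n m≥ n≥ →
      subst (ℚ._< ε)
        (trans (sym (ℚ.∣-p∣≡∣p∣ (x m ℚ.- x n))) (cong ∣_∣ (ℚ.neg-distrib-+ (x m) (ℚ.- x n))))
        (hx m n m≥ n≥)

  bounded : ∀ x → IsCauchy x → ∃[ K ] (0ℚ ℚ.< K × Eventually (λ n → ∣ x n ∣ ℚ.≤ K))
  bounded x cx with cx 1ℚ (ℚ.positive⁻¹ 1ℚ)
  ... | N , hx = 1ℚ ℚ.+ ∣ x N ∣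
      , ℚ.+-mono-<-≤ (ℚ.positive⁻¹ 1ℚ) (ℚ.0≤∣p∣ (x N))
      , N , λ n n≥ → begin
        ∣ x n ∣                          ≡⟨ cong ∣_∣ (cancel (x n) (x N)) ⟩
        ∣ (x n ℚ.- x N) ℚ.+ x N ∣        ≤⟨ ℚ.∣p+q∣≤∣p∣+∣q∣ (x n ℚ.- x N) (x N) ⟩
        ∣ x n ℚ.- x N ∣ ℚ.+ ∣ x N ∣      ≤⟨ ℚ.+-monoˡ-≤ ∣ x N ∣ (ℚ.<⇒≤ (hx n N n≥ ℕ.≤-refl)) ⟩
        1ℚ ℚ.+ ∣ x N ∣                   ∎
    where
    open ℚ.≤-Reasoning
    open +-*-Solver
    cancel : ∀ a b → a ≡ (a ℚ.- b) ℚ.+ b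
    cancel = solve 2 (λ a b → a := (a :- b) :+ b) refl

  scale : ∀ B ε → 0ℚ ℚ.< B → 0ℚ ℚ.< ε → ∃[ δ ] (0ℚ ℚ.< δ × B ℚ.* δ ≡ ε)
  scale B ε 0<B 0<ε = r ℚ.* ε , 0<rε , Brε
    where
    B-pos : ℚ.Positive B
    B-pos = ℚ.positive 0<B
    r : ℚ
    r = (ℚ.1/ B) {{ℚ.pos⇒nonZero B {{B-pos}}}}
    0<rε : 0ℚ ℚ.< r ℚ.* ε
    0<rε = subst (ℚ._< r ℚ.* ε) (ℚ.*-zeroʳ r)
      (ℚ.*-monoʳ-<-pos r {{ℚ.1/pos⇒pos B {{B-pos}}}} 0<ε)
    Brε : B ℚ.* (r ℚ.* ε) ≡ ε
    Brε = trans (sym (ℚ.*-assoc B r ε))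
      (trans (cong (ℚ._* ε) (ℚ.*-inverseʳ B {{ℚ.pos⇒nonZero B {{B-pos}}}}))
             (ℚ.*-identityˡ ε))

  product-bound : ∀ {K δ} a d → 0ℚ ℚ.< K → ∣ a ∣ ℚ.≤ K → ∣ d ∣ ℚ.< δ →
                  ∣ a ℚ.* d ∣ ℚ.< K ℚ.* δ
  product-bound {K} {δ} a d 0<K a≤K d<δ = begin-strict
    ∣ a ℚ.* d ∣       ≡⟨ ℚ.∣p*q∣≡∣p∣*∣q∣ a d ⟩
    ∣ a ∣ ℚ.* ∣ d ∣   ≤⟨ ℚ.*-monoʳ-≤-nonNeg ∣ d ∣ {{ℚ.∣-∣-nonNeg d}} a≤K ⟩
    K ℚ.* ∣ d ∣       <⟨ ℚ.*-monoʳ-<-pos K {{ℚ.positive 0<K}} d<δ ⟩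
    K ℚ.* δ           ∎
    where open ℚ.≤-Reasoning

  *-rearrange : ∀ a b c d →
    a ℚ.* b ℚ.- c ℚ.* d ≡ a ℚ.* (b ℚ.- d) ℚ.+ d ℚ.* (a ℚ.- c)
  *-rearrange = solve 4 (λ a b c d → a :* b :- c :* d := a :* (b :- d) :+ d :* (a :- c)) refl
    where open +-*-Solver

  *-difference : ∀ {ε} a b c d →
    ∣ a ℚ.* (b ℚ.- d) ∣ ℚ.< ½ ℚ.* ε → ∣ d ℚ.* (a ℚ.- c) ∣ ℚ.< ½ ℚ.* ε →
    ∣ a ℚ.* b ℚ.- c ℚ.* d ∣ ℚ.< ε
  *-difference {ε} a b c d p q = begin-strict
    ∣ a ℚ.* b ℚ.- c ℚ.* d ∣                            ≡⟨ cong ∣_∣ (*-rearrange a b c d) ⟩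
    ∣ a ℚ.* (b ℚ.- d) ℚ.+ d ℚ.* (a ℚ.- c) ∣            ≤⟨ ℚ.∣p+q∣≤∣p∣+∣q∣ (a ℚ.* (b ℚ.- d)) (d ℚ.* (a ℚ.- c)) ⟩
    ∣ a ℚ.* (b ℚ.- d) ∣ ℚ.+ ∣ d ℚ.* (a ℚ.- c) ∣        <⟨ ℚ.+-mono-< p q ⟩
    ½ ℚ.* ε ℚ.+ ½ ℚ.* ε                                ≡⟨ half+half ε ⟩
    ε                                                  ∎
    where open ℚ.≤-Reasoning

  *-cauchy : ∀ x y → IsCauchy x → IsCauchy y → IsCauchy (λ n → x n ℚ.* y n)
  *-cauchy x y cx cy ε 0<ε =
    let K , 0<K , M₁ , bx = bounded x cx
        L , 0<L , M₂ , by = bounded y cy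
        δ , 0<δ , Kδ≡ε/2 = scale K (½ ℚ.* ε) 0<K (half-pos 0<ε)
        γ , 0<γ , Lγ≡ε/2 = scale L (½ ℚ.* ε) 0<L (half-pos 0<ε)
        N₁ , hx = cx γ 0<γ
        N₂ , hy = cy δ 0<δ
        M = M₁ ℕ.⊔ M₂
        N = N₁ ℕ.⊔ N₂
    in M ℕ.⊔ N , λ m n m≥ n≥ →
      let m≥M = ℕ.m⊔n≤o⇒m≤o M N m≥
          n≥M = ℕ.m⊔n≤o⇒m≤o M N n≥
          m≥N = ℕ.m⊔n≤o⇒n≤o M N m≥
          n≥N = ℕ.m⊔n≤o⇒n≤o M N n≥
      in *-difference (x m) (y m) (x n) (y n)
           (subst (∣ x m ℚ.* (y m ℚ.- y n) ∣ ℚ.<_) Kδ≡ε/2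
             (product-bound (x m) (y m ℚ.- y n) 0<K
               (bx m (ℕ.m⊔n≤o⇒m≤o M₁ M₂ m≥M))
               (hy m n (ℕ.m⊔n≤o⇒n≤o N₁ N₂ m≥N) (ℕ.m⊔n≤o⇒n≤o N₁ N₂ n≥N))))
           (subst (∣ y n ℚ.* (x m ℚ.- x n) ∣ ℚ.<_) Lγ≡ε/2
             (product-bound (y n) (x m ℚ.- x n) 0<L
               (by n (ℕ.m⊔n≤o⇒n≤o M₁ M₂ n≥M))
               (hx m n (ℕ.m⊔n≤o⇒m≤o N₁ N₂ m≥N) (ℕ.m⊔n≤o⇒m≤o N₁ N₂ n≥N))))

fromℚ : ℚ → ℝ
fromℚ q = mkℝ (λ _ → q) (const-cauchy q)

fromℕ : ℕ → ℝ
fromℕ k = fromℚ (ℤ.+ k ℚ./ 1)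

0ᴿ 1ᴿ : ℝ
0ᴿ = fromℚ 0ℚ
1ᴿ = fromℚ 1ℚ

infixl 6 _+ᴿ_ _-ᴿ_
infixl 7 _*ᴿ_
infix  8 -ᴿ_

_+ᴿ_ : ℝ → ℝ → ℝ
x +ᴿ y = mkℝ (λ n → seq x n ℚ.+ seq y n) (+-cauchy (seq x) (seq y) (cauchy x) (cauchy y))

_*ᴿ_ : ℝ → ℝ → ℝ
x *ᴿ y = mkℝ (λ n → seq x n ℚ.* seq y n) (*-cauchy (seq x) (seq y) (cauchy x) (cauchy y))

-ᴿ_ : ℝ → ℝ
-ᴿ x = mkℝ (λ n → ℚ.- seq x n) (neg-cauchy (seq x) (cauchy x))

_-ᴿ_ : ℝ → ℝ → ℝ
x -ᴿ y = x +ᴿ (-ᴿ y)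

ℝ-rawRing : RawRing 0ℓ 0ℓ
ℝ-rawRing = record
  { Carrier = ℝ ; _≈_ = _≈ᴿ_ ; _+_ = _+ᴿ_ ; _*_ = _*ᴿ_ ; -_ = -ᴿ_ ; 0# = 0ᴿ ; 1# = 1ᴿ }

------------------------------------------------------------------------
-- Complex numbers

record ℂ : Set where
  constructor _+i_
  field
    re im : ℝ

open ℂ public

infix 4 _≈_ _#_

_≈_ : Rel ℂ 0ℓ
z ≈ w = re z ≈ᴿ re w × im z ≈ᴿ im w

-- z # 0ᶜ renders z ≠ 0 throughout, both for determinants and for
-- coefficients of polynomials.
_#_ : Rel ℂ 0ℓ
z # w = re z #ᴿ re w ⊎ im z #ᴿ im w

0ᶜ 1ᶜ : ℂ
0ᶜ = 0ᴿ +i 0ᴿ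
1ᶜ = 1ᴿ +i 0ᴿ

infixl 6 _+_
infixl 7 _*_
infix  8 -_

_+_ : ℂ → ℂ → ℂ
z + w = (re z +ᴿ re w) +i (im z +ᴿ im w)

_*_ : ℂ → ℂ → ℂ
z * w = (re z *ᴿ re w -ᴿ im z *ᴿ im w) +i (re z *ᴿ im w +ᴿ im z *ᴿ re w)

-_ : ℂ → ℂ
- z = (-ᴿ re z) +i (-ᴿ im z)

ℂ-rawRing : RawRing 0ℓ 0ℓ
ℂ-rawRing = record
  { Carrier = ℂ ; _≈_ = _≈_ ; _+_ = _+_ ; _*_ = _*_ ; -_ = -_ ; 0# = 0ᶜ ; 1# = 1ᶜ }

open RawSemiringDefinitions (RawRing.rawSemiring ℝ-rawRing)
  using () renaming (sum to sumᴿ) public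
open RawSemiringDefinitions (RawRing.rawSemiring ℂ-rawRing)
  using (sum; _^_) public

------------------------------------------------------------------------
-- Convex hulls in ℝⁿ

Point : ℕ → Set
Point n = Vector ℝ n

infix 4 _≈ₚ_

_≈ₚ_ : ∀ {n} → Rel (Point n) 0ℓ
x ≈ₚ y = ∀ i → x i ≈ᴿ y i

conv : ∀ {n} → Pred (Point n) 0ℓ → Pred (Point n) 0ℓ
conv {n} S x =
  ∃[ m ] Σ[ w ∈ Vector ℝ m ] Σ[ p ∈ Vector (Point n) m ]
    ( (∀ j → 0ᴿ ≤ᴿ w j)
    × sumᴿ w ≈ᴿ 1ᴿ
    × (∀ j → p j ∈ S)
    × (λ i → sumᴿ (λ j → w j *ᴿ p j i)) ≈ₚ x )

------------------------------------------------------------------------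
-- Polynomials in n variables and their Newton polytopes

Exponent : ℕ → Set
Exponent n = Vec ℕ n

-- A formal sum of terms c·z^k. Exponents may be repeated, so the
-- coefficient of z^k is obtained by collecting like terms.
Polynomial : ℕ → Set
Polynomial n = List (ℂ × Exponent n)

coeff : ∀ {n} → Polynomial n → Exponent n → ℂ
coeff []            k = 0ᶜ
coeff ((c , e) ∷ p) k =
  if does (Vec.≡-dec ℕ._≟_ e k) then c + coeff p k else coeff p k

lattice : ∀ {n} → Exponent n → Point n
lattice k i = fromℕ (Vec.lookup k i)

Support : ∀ {n} → Polynomial n → Pred (Point n) 0ℓ
Support p x = ∃[ k ] (coeff p k # 0ᶜ × lattice k ≈ₚ x)

NewtonPolytope : ∀ {n} → Polynomial n → Pred (Point n) 0ℓ
NewtonPolytope p = conv (Support p)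

------------------------------------------------------------------------
-- Matrices and quadratic forms

Matrix : ℕ → Set
Matrix n = Fin n → Fin n → ℂ

-- Laplace expansion along the first row.
det : ∀ {n} → Matrix n → ℂ
det {zero}  M = 1ᶜ
det {suc n} M =
  sum (λ j → (- 1ᶜ) ^ toℕ j * M zero j * det (λ i → removeAt (M (suc i)) j))

record QuadraticForm (n : ℕ) : Set where
  field
    matrix    : Matrix n
    symmetric : ∀ i j → matrix i j ≈ matrix j i

open QuadraticForm public

unit : ∀ {n} → Fin n → Exponent n
unit {n} i = Vec.replicate n 0 Vec.[ i ]≔ 1

-- Σ_{i,j} B_ij z_i z_j, where z_i z_j has exponent e_i + e_j.
toPolynomial : ∀ {n} → QuadraticForm n → Polynomial n
toPolynomial {n} B =
  map (λ (i , j) → matrix B i j , Vec.zipWith ℕ._+_ (unit i) (unit j))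
      (cartesianProduct (allFin n) (allFin n))

Nondegenerate : ∀ {n} → QuadraticForm n → Set
Nondegenerate B = det (matrix B) # 0ᶜ

{-# OPTIONS --safe #-}

-- Expanding det B along rows, some summand ∏ᵢ B i (π i) with π a permutation
-- is nonzero, so every B i (π i) is. Since B is symmetric, zᵢ z_{π i} then
-- has a nonzero coefficient, and the average of the n exponents
-- eᵢ + e_{π i} is (2/n, …, 2/n).
module Submission where

open import Defs
open import Data.Nat.Base using (ℕ; NonZero)
open import Data.Integer.Base using (+_)
open import Data.Rational.Base using (_/_)
open import Relation.Unary using (_∈_)
open import Algebra.Bundles using (CommutativeMonoid)
import Algebra.Properties.CommutativeMonoid.Sum
open import Data.Bool.Base using (true; false; if_then_else_)
open import Data.Fin.Base using (Fin; zero; suc; toℕ; punchIn; punchOut)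
open import Data.Fin.Permutation as Perm using (Permutation′; _⟨$⟩ʳ_)
import Data.Fin.Properties as Fin
import Data.Integer.Base as ℤ
import Data.Integer.Properties as ℤ
open import Data.List.Base using ([]; _∷_; _++_; map; tabulate; allFin; cartesianProduct)
open import Data.List.Properties using (map-++; map-∘; map-tabulate)
open import Data.Nat.Base as ℕ using (zero; suc)
import Data.Nat.Properties as ℕ
open import Data.Product.Base as Prod using (∃-syntax; _×_; _,_; proj₁; proj₂)
open import Data.Rational.Base as ℚ using (ℚ; 0ℚ; 1ℚ; ½; ∣_∣)
import Data.Rational.Properties as ℚ
open import Data.Rational.Solver using (module +-*-Solver)
open import Data.Rational.Unnormalised.Base as ℚᵘ using (mkℚᵘ; *≡*)
import Data.Rational.Unnormalised.Properties as ℚᵘ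
open import Data.Sum.Base as Sum using (_⊎_; inj₁; inj₂)
open import Data.Vec.Base as Vec using (Vec)
import Data.Vec.Properties as Vec
open import Data.Vec.Functional using (Vector; removeAt; replicate)
open import Function.Base using (_∘_; case_of_)
open import Relation.Binary.PropositionalEquality
  using (_≡_; _≢_; refl; sym; trans; cong; cong₂; subst; module ≡-Reasoning)
open import Relation.Nullary using (yes; no; does; contradiction)
open import Relation.Nullary.Decidable using (dec-true; dec-false)

-- Apartness from zero

-- This is `_#ᴿ 0ᴿ` with the subtraction of `0ℚ` cleared away. It speaks of bare sequences, so facts
-- about rationals apply to it term by term.
Apart₀ : (ℕ → ℚ) → Set
Apart₀ x = ∃[ ε ] (0ℚ ℚ.< ε × Eventually (λ n → ε ℚ.< ∣ x n ∣))

#ᴿ⇒Apart₀ : ∀ x → x #ᴿ 0ᴿ → Apart₀ (seq x)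
#ᴿ⇒Apart₀ x (ε , 0<ε , N , h) = ε , 0<ε , N , λ n n≥ →
  subst (λ z → ε ℚ.< ∣ z ∣) (ℚ.+-identityʳ (seq x n)) (h n n≥)

Apart₀⇒#ᴿ : ∀ x → Apart₀ (seq x) → x #ᴿ 0ᴿ
Apart₀⇒#ᴿ x (ε , 0<ε , N , h) = ε , 0<ε , N , λ n n≥ →
  subst (λ z → ε ℚ.< ∣ z ∣) (sym (ℚ.+-identityʳ (seq x n))) (h n n≥)

Apart₀-cong : ∀ {x y} → (∀ n → ∣ x n ∣ ≡ ∣ y n ∣) → Apart₀ x → Apart₀ y
Apart₀-cong eq (ε , 0<ε , N , h) = ε , 0<ε , N , λ n n≥ → subst (ε ℚ.<_) (eq n) (h n n≥)

0<½* : ∀ {ε} → 0ℚ ℚ.< ε → 0ℚ ℚ.< ½ ℚ.* ε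
0<½* {ε} 0<ε = subst (ℚ._< ½ ℚ.* ε) (ℚ.*-zeroʳ ½) (ℚ.*-monoʳ-<-pos ½ 0<ε)

½*+½* : ∀ ε → ½ ℚ.* ε ℚ.+ ½ ℚ.* ε ≡ ε
½*+½* ε = trans (sym (ℚ.*-distribʳ-+ ε ½ ½)) (ℚ.*-identityˡ ε)

∣p∣≤∣p-q∣+∣q∣ : ∀ p q → ∣ p ∣ ℚ.≤ ∣ p ℚ.- q ∣ ℚ.+ ∣ q ∣
∣p∣≤∣p-q∣+∣q∣ p q = begin
  ∣ p ∣                     ≡⟨ cong ∣_∣ (cancel p q) ⟩
  ∣ (p ℚ.- q) ℚ.+ q ∣       ≤⟨ ℚ.∣p+q∣≤∣p∣+∣q∣ (p ℚ.- q) q ⟩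
  ∣ p ℚ.- q ∣ ℚ.+ ∣ q ∣     ∎
  where
  open ℚ.≤-Reasoning
  open +-*-Solver
  cancel : ∀ a b → a ≡ (a ℚ.- b) ℚ.+ b
  cancel = solve 2 (λ a b → a := (a :- b) :+ b) refl

+-cancelˡ-<-≤ : ∀ {a b x y} → a ℚ.+ b ℚ.< x ℚ.+ y → x ℚ.≤ a → b ℚ.< y
+-cancelˡ-<-≤ {a} {b} {x} {y} a+b<x+y x≤a with b ℚ.<? y
... | yes b<y = b<y
... | no  b≮y = contradiction (ℚ.<-≤-trans a+b<x+y (ℚ.+-mono-≤ x≤a (ℚ.≮⇒≥ b≮y))) (ℚ.<-irrefl refl)

-- Past the Cauchy modulus for `η`, terms differ by less than `η`, so one term of size above `2η`
-- keeps all of them above `η`. Apartness can thus be tested at a single index.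
Apart₀-fromTail : ∀ {x} → IsCauchy x → ∀ η → 0ℚ ℚ.< η →
  ∃[ N ] (∀ M → N ℕ.≤ M → η ℚ.+ η ℚ.< ∣ x M ∣ → Apart₀ x)
Apart₀-fromTail {x} cx η 0<η with cx η 0<η
... | N , h = N , λ M M≥ big → η , 0<η , N , λ n n≥ →
      +-cancelˡ-<-≤ (ℚ.<-≤-trans big (∣p∣≤∣p-q∣+∣q∣ (x M) (x n))) (ℚ.<⇒≤ (h M n M≥ n≥))

-- At an index where the sum exceeds `ε`, one of the two summands exceeds `ε/2`. Comparison of
-- rationals is decidable, so a single comparison at `M` selects the summand, and `Apart₀-fromTail`
-- extends the bound to the whole tail.
Apart₀-+ : ∀ x y → IsCauchy x → IsCauchy y →
  Apart₀ (λ n → x n ℚ.+ y n) → Apart₀ x ⊎ Apart₀ y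
Apart₀-+ x y cx cy (ε , 0<ε , N , h) =
  case η+η ℚ.<? ∣ x M ∣ of λ where
    (yes big) → inj₁ (hx M (ℕ.m⊔n≤o⇒m≤o N₁ N₂ M≥) big)
    (no  x≤)  → inj₂ (hy M (ℕ.m⊔n≤o⇒n≤o N₁ N₂ M≥)
      (+-cancelˡ-<-≤ (begin-strict
        η+η ℚ.+ η+η             ≡⟨ cong (λ z → z ℚ.+ z) (½*+½* (½ ℚ.* ε)) ⟩
        ½ ℚ.* ε ℚ.+ ½ ℚ.* ε     ≡⟨ ½*+½* ε ⟩
        ε                       <⟨ h M (ℕ.m≤m⊔n N (N₁ ℕ.⊔ N₂)) ⟩
        ∣ x M ℚ.+ y M ∣         ≤⟨ ℚ.∣p+q∣≤∣p∣+∣q∣ (x M) (y M) ⟩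
        ∣ x M ∣ ℚ.+ ∣ y M ∣     ∎)
        (ℚ.≮⇒≥ x≤)))
  where
  open ℚ.≤-Reasoning
  η η+η : ℚ
  -- A quarter of `ε`: the threshold `η+η` is `ε/2`, and two such thresholds make up `ε`.
  η = ½ ℚ.* (½ ℚ.* ε)
  η+η = η ℚ.+ η
  tail-x = Apart₀-fromTail cx η (0<½* (0<½* 0<ε))
  tail-y = Apart₀-fromTail cy η (0<½* (0<½* 0<ε))
  N₁ = proj₁ tail-x
  hx = proj₂ tail-x
  N₂ = proj₁ tail-y
  hy = proj₂ tail-y
  M = N ℕ.⊔ (N₁ ℕ.⊔ N₂)
  M≥ : N₁ ℕ.⊔ N₂ ℕ.≤ M
  M≥ = ℕ.m≤n⊔m N (N₁ ℕ.⊔ N₂)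

IsCauchy⇒bounded : ∀ {x} → IsCauchy x → ∃[ K ] (0ℚ ℚ.< K × Eventually (λ n → ∣ x n ∣ ℚ.≤ K))
IsCauchy⇒bounded {x} cx with cx 1ℚ (ℚ.positive⁻¹ 1ℚ)
... | N , h = 1ℚ ℚ.+ ∣ x N ∣
    , ℚ.+-mono-<-≤ (ℚ.positive⁻¹ 1ℚ) (ℚ.0≤∣p∣ (x N))
    , N , λ n n≥ → ℚ.≤-trans (∣p∣≤∣p-q∣+∣q∣ (x n) (x N))
                     (ℚ.+-monoˡ-≤ ∣ x N ∣ (ℚ.<⇒≤ (h n N n≥ ℕ.≤-refl)))

divide : ∀ K ε → 0ℚ ℚ.< K → 0ℚ ℚ.< ε → ∃[ δ ] (0ℚ ℚ.< δ × K ℚ.* δ ≡ ε)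
divide K ε 0<K 0<ε = r ℚ.* ε
  , subst (ℚ._< r ℚ.* ε) (ℚ.*-zeroʳ r) (ℚ.*-monoʳ-<-pos r {{ℚ.1/pos⇒pos K {{K>0}}}} 0<ε)
  , trans (sym (ℚ.*-assoc K r ε))
      (trans (cong (ℚ._* ε) (ℚ.*-inverseʳ K {{ℚ.pos⇒nonZero K {{K>0}}}})) (ℚ.*-identityˡ ε))
  where
  K>0 : ℚ.Positive K
  K>0 = ℚ.positive 0<K
  r : ℚ
  r = (ℚ.1/ K) {{ℚ.pos⇒nonZero K {{K>0}}}}

-- A Cauchy sequence is eventually bounded by some `K`. If the product exceeds `ε = K δ`, the other
-- factor must exceed `δ`.
Apart₀-*ʳ : ∀ x y → IsCauchy x → Apart₀ (λ n → x n ℚ.* y n) → Apart₀ y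
Apart₀-*ʳ x y cx (ε , 0<ε , N , h) =
  let K , 0<K , N₁ , x≤K = IsCauchy⇒bounded cx
      δ , 0<δ , Kδ≡ε = divide K ε 0<K 0<ε
  in δ , 0<δ , N ℕ.⊔ N₁ , λ n n≥ →
    factor (x n) (y n) 0<K (subst (ℚ._< _) (sym Kδ≡ε) (h n (ℕ.m⊔n≤o⇒m≤o N N₁ n≥)))
      (x≤K n (ℕ.m⊔n≤o⇒n≤o N N₁ n≥))
  where
  open ℚ.≤-Reasoning
  factor : ∀ {K δ} p q → 0ℚ ℚ.< K → K ℚ.* δ ℚ.< ∣ p ℚ.* q ∣ → ∣ p ∣ ℚ.≤ K → δ ℚ.< ∣ q ∣
  factor {K} {δ} p q 0<K Kδ<pq p≤K =
    ℚ.*-cancelˡ-<-nonNeg K {{ℚ.nonNegative (ℚ.<⇒≤ 0<K)}} (begin-strict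
      K ℚ.* δ             <⟨ Kδ<pq ⟩
      ∣ p ℚ.* q ∣         ≡⟨ ℚ.∣p*q∣≡∣p∣*∣q∣ p q ⟩
      ∣ p ∣ ℚ.* ∣ q ∣     ≤⟨ ℚ.*-monoʳ-≤-nonNeg ∣ q ∣ {{ℚ.∣-∣-nonNeg q}} p≤K ⟩
      K ℚ.* ∣ q ∣         ∎)

Apart₀-neg : ∀ x → Apart₀ (λ n → ℚ.- x n) → Apart₀ x
Apart₀-neg x = Apart₀-cong (λ n → ℚ.∣-p∣≡∣p∣ (x n))

Apart₀-* : ∀ x y → IsCauchy x → IsCauchy y → Apart₀ (λ n → x n ℚ.* y n) → Apart₀ x × Apart₀ y
Apart₀-* x y cx cy p =
    Apart₀-*ʳ y x cy (Apart₀-cong (λ n → cong ∣_∣ (ℚ.*-comm (x n) (y n))) p)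
  , Apart₀-*ʳ x y cx p

-- From `2a = (a - b) + (a + b)` with `∣a∣ > ε` and `∣a - b∣ < ε` it follows that `∣a + b∣ > ε`. It
-- serves the off-diagonal coefficients, which are sums of two equivalent matrix entries.
x#0∧x≈y⇒x+y#0 : ∀ x y → x #ᴿ 0ᴿ → x ≈ᴿ y → (x +ᴿ y) #ᴿ 0ᴿ
x#0∧x≈y⇒x+y#0 x y x#0 x≈y with #ᴿ⇒Apart₀ x x#0
... | ε , 0<ε , N , h with x≈y ε 0<ε
... | N₁ , g = Apart₀⇒#ᴿ (x +ᴿ y) (ε , 0<ε , N ℕ.⊔ N₁ , λ n n≥ →
  let a = seq x n
      b = seq y n
      ε<a = h n (ℕ.m⊔n≤o⇒m≤o N N₁ n≥)
      a-b<ε = g n (ℕ.m⊔n≤o⇒n≤o N N₁ n≥)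
  in +-cancelˡ-<-≤ (begin-strict
       ε ℚ.+ ε                                 <⟨ ℚ.+-mono-< ε<a ε<a ⟩
       ∣ a ∣ ℚ.+ ∣ a ∣                         ≡⟨ double ∣ a ∣ ⟩
       ∣ 1ℚ ℚ.+ 1ℚ ∣ ℚ.* ∣ a ∣                 ≡⟨ ℚ.∣p*q∣≡∣p∣*∣q∣ (1ℚ ℚ.+ 1ℚ) a ⟨
       ∣ (1ℚ ℚ.+ 1ℚ) ℚ.* a ∣                   ≡⟨ cong ∣_∣ (rearrange a b) ⟩
       ∣ (a ℚ.- b) ℚ.+ (a ℚ.+ b) ∣             ≤⟨ ℚ.∣p+q∣≤∣p∣+∣q∣ (a ℚ.- b) (a ℚ.+ b) ⟩
       ∣ a ℚ.- b ∣ ℚ.+ ∣ a ℚ.+ b ∣             ∎)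
     (ℚ.<⇒≤ a-b<ε))
  where
  open ℚ.≤-Reasoning
  open +-*-Solver
  double : ∀ a → a ℚ.+ a ≡ (1ℚ ℚ.+ 1ℚ) ℚ.* a
  double = solve 1 (λ a → a :+ a := con (1ℚ ℚ.+ 1ℚ) :* a) refl
  rearrange : ∀ a b → (1ℚ ℚ.+ 1ℚ) ℚ.* a ≡ (a ℚ.- b) ℚ.+ (a ℚ.+ b)
  rearrange = solve 2 (λ a b → con (1ℚ ℚ.+ 1ℚ) :* a := (a :- b) :+ (a :+ b)) refl

0#0-absurd : ∀ {A : Set} → 0ᴿ #ᴿ 0ᴿ → A
0#0-absurd (ε , 0<ε , N , h) = contradiction (ℚ.<-trans 0<ε (h N ℕ.≤-refl)) (ℚ.<-irrefl refl)

Apart₀-+ᴿ : ∀ x y → Apart₀ (seq (x +ᴿ y)) → Apart₀ (seq x) ⊎ Apart₀ (seq y)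
Apart₀-+ᴿ x y = Apart₀-+ (seq x) (seq y) (cauchy x) (cauchy y)

Apart₀-*ᴿ : ∀ x y → Apart₀ (seq (x *ᴿ y)) → Apart₀ (seq x) × Apart₀ (seq y)
Apart₀-*ᴿ x y = Apart₀-* (seq x) (seq y) (cauchy x) (cauchy y)

-- Apartness from zero in the complex numbers

ApartParts : ℂ → Set
ApartParts z = Apart₀ (seq (re z)) ⊎ Apart₀ (seq (im z))

#0⇒ApartParts : ∀ z → z # 0ᶜ → ApartParts z
#0⇒ApartParts z (inj₁ p) = inj₁ (#ᴿ⇒Apart₀ (re z) p)
#0⇒ApartParts z (inj₂ p) = inj₂ (#ᴿ⇒Apart₀ (im z) p)

ApartParts⇒#0 : ∀ z → ApartParts z → z # 0ᶜ
ApartParts⇒#0 z (inj₁ p) = inj₁ (Apart₀⇒#ᴿ (re z) p)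
ApartParts⇒#0 z (inj₂ p) = inj₂ (Apart₀⇒#ᴿ (im z) p)

ApartParts-+ : ∀ z w → ApartParts (z + w) → ApartParts z ⊎ ApartParts w
ApartParts-+ z w (inj₁ p) = Sum.map inj₁ inj₁ (Apart₀-+ᴿ (re z) (re w) p)
ApartParts-+ z w (inj₂ p) = Sum.map inj₂ inj₂ (Apart₀-+ᴿ (im z) (im w) p)

-- Each part of the product is a sum or difference of two real products. One of these is apart from
-- zero, and it has one real factor from `z` and one from `w`.
ApartParts-* : ∀ z w → ApartParts (z * w) → ApartParts z × ApartParts w
ApartParts-* (a +i b) (c +i d) (inj₁ p) = Sum.[ ac , bd ]′ (Apart₀-+ᴿ (a *ᴿ c) (-ᴿ (b *ᴿ d)) p)
  where
  ac : Apart₀ (seq (a *ᴿ c)) → ApartParts (a +i b) × ApartParts (c +i d)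
  ac q = Prod.map inj₁ inj₁ (Apart₀-*ᴿ a c q)
  bd : Apart₀ (seq (-ᴿ (b *ᴿ d))) → ApartParts (a +i b) × ApartParts (c +i d)
  bd q = Prod.map inj₂ inj₂ (Apart₀-*ᴿ b d (Apart₀-neg (seq (b *ᴿ d)) q))
ApartParts-* (a +i b) (c +i d) (inj₂ p) = Sum.[ ad , bc ]′ (Apart₀-+ᴿ (a *ᴿ d) (b *ᴿ c) p)
  where
  ad : Apart₀ (seq (a *ᴿ d)) → ApartParts (a +i b) × ApartParts (c +i d)
  ad q = Prod.map inj₁ inj₂ (Apart₀-*ᴿ a d q)
  bc : Apart₀ (seq (b *ᴿ c)) → ApartParts (a +i b) × ApartParts (c +i d)
  bc q = Prod.map inj₂ inj₁ (Apart₀-*ᴿ b c q)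

+-#0 : ∀ z w → (z + w) # 0ᶜ → z # 0ᶜ ⊎ w # 0ᶜ
+-#0 z w p = Sum.map (ApartParts⇒#0 z) (ApartParts⇒#0 w) (ApartParts-+ z w (#0⇒ApartParts (z + w) p))

*-#0 : ∀ z w → (z * w) # 0ᶜ → z # 0ᶜ × w # 0ᶜ
*-#0 z w p = Prod.map (ApartParts⇒#0 z) (ApartParts⇒#0 w) (ApartParts-* z w (#0⇒ApartParts (z * w) p))

-- The sum enters through an equation because det M and its Laplace expansion
-- are cheap to compare as complex numbers, but not under the unfolded _#_.
sum-#0 : ∀ {n} (f : Vector ℂ n) {z} → z ≡ sum f → z # 0ᶜ → ∃[ j ] f j # 0ᶜ
sum-#0 {zero}  f refl p = 0#0-absurd (Sum.[ (λ q → q) , (λ q → q) ]′ p)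
sum-#0 {suc n} f refl p = Sum.[ head , tail ]′ (+-#0 (f zero) (sum (f ∘ suc)) p)
  where
  head : f zero # 0ᶜ → ∃[ j ] f j # 0ᶜ
  head q = zero , q
  tail : sum (f ∘ suc) # 0ᶜ → ∃[ j ] f j # 0ᶜ
  tail q = let j , r = sum-#0 (f ∘ suc) refl q in suc j , r

-- A transversal of nonzero entries from a nonzero determinant

-- Induction along the Laplace expansion: a nonzero summand has a nonzero entry `M zero j` and a
-- nonzero minor. The permutation found for the minor is extended by `zero ↦ j`.
det-#0⇒transversal : ∀ {n} (M : Matrix n) → det M # 0ᶜ →
  ∃[ π ] (∀ i → M i (π ⟨$⟩ʳ i) # 0ᶜ)
det-#0⇒transversal {zero}  M p = Perm.id , λ ()
det-#0⇒transversal {suc n} M p =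
  let j , q        = sum-#0 (λ j → (- 1ᶜ) ^ toℕ j * M zero j * det (λ i → removeAt (M (suc i)) j))
                       {det M} refl p
      sM#0 , d#0   = *-#0 ((- 1ᶜ) ^ toℕ j * M zero j) (det (λ i → removeAt (M (suc i)) j)) q
      _ , M#0      = *-#0 ((- 1ᶜ) ^ toℕ j) (M zero j) sM#0
      π , h        = det-#0⇒transversal (λ i → removeAt (M (suc i)) j) d#0
  in Perm.insert zero j π , extend j π M#0 h
  where
  extend : ∀ j (π : Permutation′ n) → M zero j # 0ᶜ → (∀ i → removeAt (M (suc i)) j (π ⟨$⟩ʳ i) # 0ᶜ) →
    ∀ i → M i (Perm.insert zero j π ⟨$⟩ʳ i) # 0ᶜ
  extend j π M#0 h zero    = M#0
  extend j π M#0 h (suc i) =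
    -- The extended permutation sends `suc i` to `punchIn j (π i)`, which is the column that
    -- `removeAt` reads at position `π i` of the minor.
    subst (_# 0ᶜ) (cong (M (suc i)) (sym (Perm.insert-punchIn zero j π i))) (h i)

-- Finite sums

module FiniteSums {c ℓ} (A : CommutativeMonoid c ℓ) where

  open CommutativeMonoid A using (Carrier; setoid; identityʳ; ∙-congˡ)
    renaming (_≈_ to _≈ᴬ_; _∙_ to _⊹_; ε to 0ᴬ; trans to ≈-trans)
  open Algebra.Properties.CommutativeMonoid.Sum A renaming (sum to ∑)
  open import Relation.Binary.Reasoning.Setoid setoid

  ∑-zero : ∀ {n} (f : Vector Carrier n) → (∀ a → f a ≈ᴬ 0ᴬ) → ∑ f ≈ᴬ 0ᴬ
  ∑-zero {n} f f≈0 = ≈-trans (sum-cong-≋ f≈0) (sum-replicate-zero n)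

  ∑-supportedAt : ∀ {n} (f : Vector Carrier n) i → (∀ a → a ≢ i → f a ≈ᴬ 0ᴬ) → ∑ f ≈ᴬ f i
  ∑-supportedAt {suc n} f i f≈0 = begin
    ∑ f                        ≈⟨ sum-remove f ⟩
    f i ⊹ ∑ (removeAt f i)     ≈⟨ ∙-congˡ (∑-zero (removeAt f i) (λ a → f≈0 _ (Fin.punchInᵢ≢i i a))) ⟩
    f i ⊹ 0ᴬ                   ≈⟨ identityʳ (f i) ⟩
    f i                        ∎

  -- Once position `i` is removed, position `j` is found at `punchOut i≢j`, and the remaining sum is
  -- supported at that one point.
  ∑-supportedAt₂ : ∀ {n} (f : Vector Carrier n) {i j} → i ≢ j →
    (∀ a → a ≢ i → a ≢ j → f a ≈ᴬ 0ᴬ) → ∑ f ≈ᴬ f i ⊹ f j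
  ∑-supportedAt₂ {suc n} f {i} {j} i≢j f≈0 = begin
    ∑ f                                         ≈⟨ sum-remove f ⟩
    f i ⊹ ∑ (removeAt f i)                      ≈⟨ ∙-congˡ (∑-supportedAt (removeAt f i) (punchOut i≢j) rest) ⟩
    f i ⊹ f (punchIn i (punchOut i≢j))          ≡⟨ cong (λ k → f i ⊹ f k) (Fin.punchIn-punchOut i≢j) ⟩
    f i ⊹ f j                                   ∎
    where
    rest : ∀ a → a ≢ punchOut i≢j → f (punchIn i a) ≈ᴬ 0ᴬ
    rest a a≢ = f≈0 _ (Fin.punchInᵢ≢i i a) λ eq → a≢
      (Fin.punchIn-injective i _ _ (trans eq (sym (Fin.punchIn-punchOut i≢j))))

-- Exponents of quadratic monomials

infixl 6 _⊕_
_⊕_ : ∀ {n} → Exponent n → Exponent n → Exponent n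
_⊕_ = Vec.zipWith ℕ._+_

lookup-unit-≡ : ∀ {n} (i : Fin n) → Vec.lookup (unit i) i ≡ 1
lookup-unit-≡ {n} i = Vec.lookup∘update i (Vec.replicate n 0) 1

lookup-unit-≢ : ∀ {n} {i k : Fin n} → k ≢ i → Vec.lookup (unit i) k ≡ 0
lookup-unit-≢ {n} {i} {k} k≢i =
  trans (Vec.lookup∘update′ k≢i (Vec.replicate n 0) 1) (Vec.lookup-replicate k 0)

unit-injective : ∀ {n} {i j : Fin n} → unit i ≡ unit j → i ≡ j
unit-injective {i = i} {j} eq with i Fin.≟ j
... | yes i≡j = i≡j
... | no  i≢j = contradiction
  (trans (sym (lookup-unit-≡ i)) (trans (cong (λ v → Vec.lookup v i) eq) (lookup-unit-≢ i≢j))) λ ()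

⊕-comm : ∀ {n} (u v : Exponent n) → u ⊕ v ≡ v ⊕ u
⊕-comm = Vec.zipWith-comm ℕ.+-comm

⊕-cancelˡ : ∀ {n} (u : Exponent n) {v w} → u ⊕ v ≡ u ⊕ w → v ≡ w
⊕-cancelˡ Vec.[]      {Vec.[]}    {Vec.[]}    eq = refl
⊕-cancelˡ (x Vec.∷ u) {y Vec.∷ v} {z Vec.∷ w} eq =
  cong₂ Vec._∷_ (ℕ.+-cancelˡ-≡ x y z (Vec.∷-injectiveˡ eq)) (⊕-cancelˡ u (Vec.∷-injectiveʳ eq))

-- The left side is positive at coordinate `a`, which forces `a` to be `i` or `j`. Cancelling the
-- common unit vector then identifies `b`.
unit⊕unit-≡ : ∀ {n} {a b i j : Fin n} → unit a ⊕ unit b ≡ unit i ⊕ unit j →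
  (a ≡ i × b ≡ j) ⊎ (a ≡ j × b ≡ i)
unit⊕unit-≡ {a = a} {b} {i} {j} eq with a Fin.≟ i | a Fin.≟ j
... | yes refl | _        = inj₁ (refl , unit-injective (⊕-cancelˡ (unit a) eq))
... | no _     | yes refl = inj₂ (refl , unit-injective
                              (⊕-cancelˡ (unit a) (trans eq (⊕-comm (unit i) (unit a)))))
... | no a≢i   | no a≢j   = contradiction (begin
    suc (Vec.lookup (unit b) a)                          ≡⟨ cong (ℕ._+ Vec.lookup (unit b) a) (lookup-unit-≡ a) ⟨
    Vec.lookup (unit a) a ℕ.+ Vec.lookup (unit b) a      ≡⟨ Vec.lookup-zipWith ℕ._+_ a (unit a) (unit b) ⟨
    Vec.lookup (unit a ⊕ unit b) a                       ≡⟨ cong (λ v → Vec.lookup v a) eq ⟩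
    Vec.lookup (unit i ⊕ unit j) a                       ≡⟨ Vec.lookup-zipWith ℕ._+_ a (unit i) (unit j) ⟩
    Vec.lookup (unit i) a ℕ.+ Vec.lookup (unit j) a      ≡⟨ cong₂ ℕ._+_ (lookup-unit-≢ a≢i) (lookup-unit-≢ a≢j) ⟩
    0                                                    ∎) λ ()
  where open ≡-Reasoning

-- ℂ carries no proof of being a monoid, so coefficients are computed through
-- additive maps φ, in the end the rational approximations of real and
-- imaginary parts. Keeping the target abstract stops ℚ._+_ from unfolding.
module Coefficients {c ℓ} (A : CommutativeMonoid c ℓ)
  (φ : ℂ → CommutativeMonoid.Carrier A)
  (φ-+ : ∀ z w → CommutativeMonoid._≈_ A (φ (z + w)) (CommutativeMonoid._∙_ A (φ z) (φ w)))
  (φ-0 : CommutativeMonoid._≈_ A (φ 0ᶜ) (CommutativeMonoid.ε A))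
  where

  open CommutativeMonoid A using (setoid; identityˡ; assoc; ∙-cong; ∙-congˡ; ∙-congʳ; reflexive)
    renaming (Carrier to |A|; _≈_ to _≈ᴬ_; _∙_ to _⊹_; ε to 0ᴬ; sym to ≈-sym; trans to ≈-trans)
  open Algebra.Properties.CommutativeMonoid.Sum A renaming (sum to ∑)
  open FiniteSums A
  open import Relation.Binary.Reasoning.Setoid setoid

  term : ∀ {n} → Exponent n → ℂ × Exponent n → |A|
  term k (c , e) = if does (Vec.≡-dec ℕ._≟_ e k) then φ c else 0ᴬ

  φ-if : ∀ b c z → φ (if b then c + z else z) ≈ᴬ (if b then φ c else 0ᴬ) ⊹ φ z
  φ-if true  c z = φ-+ c z
  φ-if false c z = ≈-sym (identityˡ (φ z))

  coeff-∷ : ∀ {n} t (p : Polynomial n) k → φ (coeff (t ∷ p) k) ≈ᴬ term k t ⊹ φ (coeff p k)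
  coeff-∷ (c , e) p k = φ-if (does (Vec.≡-dec ℕ._≟_ e k)) c (coeff p k)

  coeff-++ : ∀ {n} (p q : Polynomial n) k →
    φ (coeff (p ++ q) k) ≈ᴬ φ (coeff p k) ⊹ φ (coeff q k)
  coeff-++ []      q k = ≈-sym (≈-trans (∙-congʳ φ-0) (identityˡ _))
  coeff-++ (t ∷ p) q k = begin
    φ (coeff (t ∷ (p ++ q)) k)                         ≈⟨ coeff-∷ t (p ++ q) k ⟩
    term k t ⊹ φ (coeff (p ++ q) k)                    ≈⟨ ∙-congˡ (coeff-++ p q k) ⟩
    term k t ⊹ (φ (coeff p k) ⊹ φ (coeff q k))         ≈⟨ assoc _ _ _ ⟨
    (term k t ⊹ φ (coeff p k)) ⊹ φ (coeff q k)         ≈⟨ ∙-congʳ (coeff-∷ t p k) ⟨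
    φ (coeff (t ∷ p) k) ⊹ φ (coeff q k)                ∎

  coeff-tabulate : ∀ {n m} (f : Fin m → ℂ × Exponent n) k →
    φ (coeff (tabulate f) k) ≈ᴬ ∑ (λ b → term k (f b))
  coeff-tabulate {m = zero}  f k = φ-0
  coeff-tabulate {m = suc m} f k =
    ≈-trans (coeff-∷ (f zero) (tabulate (f ∘ suc)) k) (∙-congˡ (coeff-tabulate (f ∘ suc) k))

  -- The first factor is a general `tabulate g` because the induction passes from `g` to `g ∘ suc`,
  -- and so leaves the form `allFin`.
  coeff-cartesianProduct : ∀ {n m l} {X : Set} (f : X × Fin m → ℂ × Exponent n) (g : Fin l → X) k →
    φ (coeff (map f (cartesianProduct (tabulate g) (allFin m))) k)
      ≈ᴬ ∑ (λ a → ∑ (λ b → term k (f (g a , b))))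
  coeff-cartesianProduct {l = zero}          f g k = φ-0
  coeff-cartesianProduct {m = m} {l = suc l} f g k = begin
    φ (coeff (map f (row ++ rest)) k)
      ≡⟨ cong (λ p → φ (coeff p k)) (map-++ f row rest) ⟩
    φ (coeff (map f row ++ map f rest) k)
      ≈⟨ coeff-++ (map f row) (map f rest) k ⟩
    φ (coeff (map f row) k) ⊹ φ (coeff (map f rest) k)
      ≈⟨ ∙-cong
           (≈-trans (reflexive (cong (λ p → φ (coeff p k))
                      (trans (sym (map-∘ (allFin m))) (map-tabulate (λ b → b) (λ b → f (g zero , b))))))
                    (coeff-tabulate (λ b → f (g zero , b)) k))
           (coeff-cartesianProduct f (g ∘ suc) k) ⟩
    ∑ (λ b → term k (f (g zero , b))) ⊹ ∑ (λ a → ∑ (λ b → term k (f (g (suc a) , b))))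
      ∎
    where
    row = map (g zero ,_) (allFin m)
    rest = cartesianProduct (tabulate (g ∘ suc)) (allFin m)

  module _ {n} (B : QuadraticForm n) where

    -- The contribution of the summand `B_ab z_a z_b` to the coefficient of `z_i z_j`.
    entry : (i j a b : Fin n) → |A|
    entry i j a b = term (unit i ⊕ unit j) (matrix B a b , unit a ⊕ unit b)

    entry-≡ : ∀ {i j a b} → unit a ⊕ unit b ≡ unit i ⊕ unit j → entry i j a b ≈ᴬ φ (matrix B a b)
    entry-≡ {a = a} {b} eq = reflexive
      (cong (λ t → if t then φ (matrix B a b) else 0ᴬ) (dec-true (Vec.≡-dec ℕ._≟_ _ _) eq))

    entry-≢ : ∀ {i j a b} → unit a ⊕ unit b ≢ unit i ⊕ unit j → entry i j a b ≈ᴬ 0ᴬ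
    entry-≢ {a = a} {b} neq = reflexive
      (cong (λ t → if t then φ (matrix B a b) else 0ᴬ) (dec-false (Vec.≡-dec ℕ._≟_ _ _) neq))

    coeff-toPolynomial : ∀ i j →
      φ (coeff (toPolynomial B) (unit i ⊕ unit j)) ≈ᴬ ∑ (λ a → ∑ (entry i j a))
    coeff-toPolynomial i j = coeff-cartesianProduct {m = n} {l = n}
      (λ (a , b) → matrix B a b , unit a ⊕ unit b) (λ a → a) (unit i ⊕ unit j)

    row-zero : ∀ i j a → a ≢ i → a ≢ j → ∑ (entry i j a) ≈ᴬ 0ᴬ
    row-zero i j a a≢i a≢j = ∑-zero (entry i j a) λ b → entry-≢ λ eq →
      Sum.[ a≢i ∘ proj₁ , a≢j ∘ proj₁ ] (unit⊕unit-≡ eq)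

    row-left : ∀ i j → ∑ (entry i j i) ≈ᴬ φ (matrix B i j)
    row-left i j = ≈-trans
      (∑-supportedAt (entry i j i) j λ b b≢j → entry-≢ λ eq →
        b≢j (unit-injective (⊕-cancelˡ (unit i) eq)))
      (entry-≡ refl)

    row-right : ∀ i j → ∑ (entry i j j) ≈ᴬ φ (matrix B j i)
    row-right i j = ≈-trans
      (∑-supportedAt (entry i j j) i λ b b≢i → entry-≢ λ eq →
        b≢i (unit-injective (⊕-cancelˡ (unit j) (trans eq (⊕-comm (unit i) (unit j))))))
      (entry-≡ (⊕-comm (unit j) (unit i)))

    -- Only the pair `(i , i)` yields this exponent, so a single row of the double sum survives.
    coeff-diagonal : ∀ i → φ (coeff (toPolynomial B) (unit i ⊕ unit i)) ≈ᴬ φ (matrix B i i)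
    coeff-diagonal i = begin
      φ (coeff (toPolynomial B) (unit i ⊕ unit i))   ≈⟨ coeff-toPolynomial i i ⟩
      ∑ (λ a → ∑ (entry i i a))                      ≈⟨ ∑-supportedAt _ i (λ a a≢i → row-zero i i a a≢i a≢i) ⟩
      ∑ (entry i i i)                                ≈⟨ row-left i i ⟩
      φ (matrix B i i)                               ∎

    -- The exponent arises from `(i , j)` and from `(j , i)`, which lie in distinct rows of the
    -- double sum.
    coeff-offDiagonal : ∀ {i j} → i ≢ j →
      φ (coeff (toPolynomial B) (unit i ⊕ unit j)) ≈ᴬ φ (matrix B i j) ⊹ φ (matrix B j i)
    coeff-offDiagonal {i} {j} i≢j = begin
      φ (coeff (toPolynomial B) (unit i ⊕ unit j))   ≈⟨ coeff-toPolynomial i j ⟩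
      ∑ (λ a → ∑ (entry i j a))                      ≈⟨ ∑-supportedAt₂ _ i≢j (row-zero i j) ⟩
      ∑ (entry i j i) ⊹ ∑ (entry i j j)              ≈⟨ ∙-cong (row-left i j) (row-right i j) ⟩
      φ (matrix B i j) ⊹ φ (matrix B j i)            ∎

-- From nonzero matrix entries to nonzero coefficients

#ᴿ-cong : ∀ x y → (∀ n → seq x n ≡ seq y n) → x #ᴿ 0ᴿ → y #ᴿ 0ᴿ
#ᴿ-cong x y eq p = Apart₀⇒#ᴿ y (Apart₀-cong (λ n → cong ∣_∣ (eq n)) (#ᴿ⇒Apart₀ x p))

module Re n = Coefficients ℚ.+-0-commutativeMonoid (λ z → seq (re z) n) (λ _ _ → refl) refl
module Im n = Coefficients ℚ.+-0-commutativeMonoid (λ z → seq (im z) n) (λ _ _ → refl) refl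

-- Symmetry rules out cancellation: off the diagonal the coefficient is `B_ij + B_ji`, that is,
-- twice `B_ij`; on the diagonal it is the entry itself.
matrix-#0⇒coeff-#0 : ∀ {n} (B : QuadraticForm n) i j → matrix B i j # 0ᶜ →
  coeff (toPolynomial B) (unit i ⊕ unit j) # 0ᶜ
matrix-#0⇒coeff-#0 B i j p with i Fin.≟ j
... | yes refl = Sum.map
  (#ᴿ-cong (re z) (re k) λ n → sym (Re.coeff-diagonal n B i))
  (#ᴿ-cong (im z) (im k) λ n → sym (Im.coeff-diagonal n B i)) p
  where
  z = matrix B i i
  k = coeff (toPolynomial B) (unit i ⊕ unit i)
... | no i≢j = Sum.map
  (λ q → #ᴿ-cong (re z +ᴿ re w) (re k) (λ n → sym (Re.coeff-offDiagonal n B i≢j))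
    (x#0∧x≈y⇒x+y#0 (re z) (re w) q (proj₁ (symmetric B i j))))
  (λ q → #ᴿ-cong (im z +ᴿ im w) (im k) (λ n → sym (Im.coeff-offDiagonal n B i≢j))
    (x#0∧x≈y⇒x+y#0 (im z) (im w) q (proj₂ (symmetric B i j)))) p
  where
  z = matrix B i j
  w = matrix B j i
  k = coeff (toPolynomial B) (unit i ⊕ unit j)

-- Averaging the exponents

open Algebra.Properties.CommutativeMonoid.Sum ℚ.+-0-commutativeMonoid renaming (sum to ∑)
open FiniteSums ℚ.+-0-commutativeMonoid

≈ᴿ-pointwise : ∀ x y → (∀ n → seq x n ≡ seq y n) → x ≈ᴿ y
≈ᴿ-pointwise x y eq ε 0<ε = 0 , λ n _ → subst (ℚ._< ε)
  (cong ∣_∣ (trans (sym (ℚ.+-inverseʳ (seq y n))) (cong (ℚ._- seq y n) (sym (eq n))))) 0<ε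

≈ᴿ-refl : ∀ x → x ≈ᴿ x
≈ᴿ-refl x = ≈ᴿ-pointwise x x (λ _ → refl)

lattice∈Support : ∀ {n} (p : Polynomial n) k → coeff p k # 0ᶜ → lattice k ∈ Support p
lattice∈Support p k k#0 = k , k#0 , λ l → ≈ᴿ-refl (lattice k l)

seq-sumᴿ : ∀ {m} (f : Vector ℝ m) n → seq (sumᴿ f) n ≡ ∑ (λ j → seq (f j) n)
seq-sumᴿ {zero}  f n = refl
seq-sumᴿ {suc m} f n = cong (seq (f zero) n ℚ.+_) (seq-sumᴿ (f ∘ suc) n)

-- In unnormalised rationals, where no common factors are cancelled, the claim is an integer
-- identity obtained by cross-multiplying.
/-distribʳ-+ : ∀ a b d → + (a ℕ.+ b) / suc d ≡ + a / suc d ℚ.+ + b / suc d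
/-distribʳ-+ a b d = ℚ.toℚᵘ-injective (begin
  ℚ.toℚᵘ (+ (a ℕ.+ b) / suc d)                     ≈⟨ ℚ.toℚᵘ-fromℚᵘ (mkℚᵘ (+ (a ℕ.+ b)) d) ⟩
  mkℚᵘ (+ (a ℕ.+ b)) d                             ≈⟨ *≡* cross ⟩
  mkℚᵘ (+ a) d ℚᵘ.+ mkℚᵘ (+ b) d                   ≈⟨ ℚᵘ.+-cong (ℚ.toℚᵘ-fromℚᵘ (mkℚᵘ (+ a) d)) (ℚ.toℚᵘ-fromℚᵘ (mkℚᵘ (+ b) d)) ⟨
  ℚ.toℚᵘ (+ a / suc d) ℚᵘ.+ ℚ.toℚᵘ (+ b / suc d)   ≈⟨ ℚ.toℚᵘ-homo-+ (+ a / suc d) (+ b / suc d) ⟨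
  ℚ.toℚᵘ (+ a / suc d ℚ.+ + b / suc d)             ∎)
  where
  open ℚᵘ.≃-Reasoning
  D = + suc d
  cross : + (a ℕ.+ b) ℤ.* (D ℤ.* D) ≡ (+ a ℤ.* D ℤ.+ + b ℤ.* D) ℤ.* D
  cross = trans (sym (ℤ.*-assoc (+ (a ℕ.+ b)) D D))
    (cong (ℤ._* D) (ℤ.*-distribʳ-+ D (+ a) (+ b)))

∑-replicate-1/ : ∀ m d → ∑ (replicate m (+ 1 / suc d)) ≡ + m / suc d
∑-replicate-1/ zero    d = sym (ℚ.0/n≡0 (suc d))
∑-replicate-1/ (suc m) d =
  trans (cong (+ 1 / suc d ℚ.+_) (∑-replicate-1/ m d)) (sym (/-distribʳ-+ 1 m d))

n/n≡1 : ∀ d → + suc d / suc d ≡ 1ℚ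
n/n≡1 d = ℚ.fromℚᵘ-cong {mkℚᵘ (+ suc d) d} {mkℚᵘ (+ 1) 0} (*≡* (ℤ.*-comm (+ suc d) (+ 1)))

coordinate : ∀ {n} → Fin n → Exponent n → ℚ
coordinate l e = + Vec.lookup e l / 1

coordinate-⊕ : ∀ {n} (l : Fin n) u v → coordinate l (u ⊕ v) ≡ coordinate l u ℚ.+ coordinate l v
coordinate-⊕ l u v = trans
  (cong (λ m → + m / 1) (Vec.lookup-zipWith ℕ._+_ l u v))
  (/-distribʳ-+ (Vec.lookup u l) (Vec.lookup v l) 0)

coordinate-unit-≡ : ∀ {n} (l : Fin n) → coordinate l (unit l) ≡ 1ℚ
coordinate-unit-≡ l = cong (λ m → + m / 1) (lookup-unit-≡ l)

coordinate-unit-≢ : ∀ {n} {l i : Fin n} → l ≢ i → coordinate l (unit i) ≡ 0ℚ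
coordinate-unit-≢ l≢i = cong (λ m → + m / 1) (lookup-unit-≢ l≢i)

∑-unit : ∀ {n} w (l : Fin n) → ∑ (λ i → w ℚ.* coordinate l (unit i)) ≡ w
∑-unit w l = begin
  ∑ (λ i → w ℚ.* coordinate l (unit i))
    ≡⟨ ∑-supportedAt (λ i → w ℚ.* coordinate l (unit i)) l (λ i i≢l →
         trans (cong (w ℚ.*_) (coordinate-unit-≢ (i≢l ∘ sym))) (ℚ.*-zeroʳ w)) ⟩
  w ℚ.* coordinate l (unit l)
    ≡⟨ cong (w ℚ.*_) (coordinate-unit-≡ l) ⟩
  w ℚ.* 1ℚ
    ≡⟨ ℚ.*-identityʳ w ⟩
  w ∎
  where open ≡-Reasoning

-- The sum splits into one over `unit i` and one over `unit (π i)`. Reindexing by the permutation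
-- makes the second equal to the first, and each has the value `w`.
∑-unit⊕unit : ∀ {n} w (π : Permutation′ n) l →
  ∑ (λ i → w ℚ.* coordinate l (unit i ⊕ unit (π ⟨$⟩ʳ i))) ≡ w ℚ.+ w
∑-unit⊕unit w π l = begin
  ∑ (λ i → w ℚ.* coordinate l (unit i ⊕ unit (π ⟨$⟩ʳ i)))
    ≡⟨ sum-cong-≗ (λ i → trans (cong (w ℚ.*_) (coordinate-⊕ l (unit i) (unit (π ⟨$⟩ʳ i))))
                               (ℚ.*-distribˡ-+ w _ _)) ⟩
  ∑ (λ i → f i ℚ.+ f (π ⟨$⟩ʳ i))
    ≡⟨ ∑-distrib-+ f (λ i → f (π ⟨$⟩ʳ i)) ⟩
  ∑ f ℚ.+ ∑ (λ i → f (π ⟨$⟩ʳ i))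
    ≡⟨ cong (∑ f ℚ.+_) (sum-permute f π) ⟨
  ∑ f ℚ.+ ∑ f
    ≡⟨ cong₂ ℚ._+_ (∑-unit w l) (∑-unit w l) ⟩
  w ℚ.+ w ∎
  where
  open ≡-Reasoning
  f : Fin _ → ℚ
  f i = w ℚ.* coordinate l (unit i)

-- Rational weights and lattice points are constant sequences, so the real conditions of `conv`
-- reduce to statements about rationals at each index.
∈-conv : ∀ {n m} (S : Point n → Set) (w : Vector ℚ m) (p : Vector (Exponent n) m) (x : Vector ℚ n) →
  (∀ j → 0ℚ ℚ.≤ w j) → ∑ w ≡ 1ℚ → (∀ j → lattice (p j) ∈ S) →
  (∀ l → ∑ (λ j → w j ℚ.* coordinate l (p j)) ≡ x l) → (λ l → fromℚ (x l)) ∈ conv S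
∈-conv {m = m} S w p x w≥0 ∑w≡1 p∈S ∑wp≡x =
    m , (λ j → fromℚ (w j)) , (λ j → lattice (p j))
  , (λ j ε 0<ε → 0 , λ _ _ → ℚ.+-mono-≤-< (w≥0 j) 0<ε)
  , ≈ᴿ-pointwise (sumᴿ (λ j → fromℚ (w j))) 1ᴿ
      (λ k → trans (seq-sumᴿ (λ j → fromℚ (w j)) k) ∑w≡1)
  , p∈S
  , λ l → ≈ᴿ-pointwise (sumᴿ (λ j → fromℚ (w j) *ᴿ lattice (p j) l)) (fromℚ (x l))
      (λ k → trans (seq-sumᴿ (λ j → fromℚ (w j) *ᴿ lattice (p j) l) k) (∑wp≡x l))

average∈NewtonPolytope : ∀ {n} (B : QuadraticForm n) → Nondegenerate B →
  ∀ w t → 0ℚ ℚ.≤ w → ∑ (replicate n w) ≡ 1ℚ → w ℚ.+ w ≡ t →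
  (λ _ → fromℚ t) ∈ NewtonPolytope (toPolynomial B)
average∈NewtonPolytope {n} B det#0 w t w≥0 ∑w≡1 w+w≡t =
  let π , B#0 = det-#0⇒transversal (matrix B) det#0 in
  ∈-conv (Support (toPolynomial B)) (replicate n w) (λ i → unit i ⊕ unit (π ⟨$⟩ʳ i)) (λ _ → t)
    (λ _ → w≥0) ∑w≡1
    (λ i → lattice∈Support (toPolynomial B) _ (matrix-#0⇒coeff-#0 B i (π ⟨$⟩ʳ i) (B#0 i)))
    (λ l → trans (∑-unit⊕unit w π l) w+w≡t)

theorem1 : (n : ℕ) .{{_ : NonZero n}} (B : QuadraticForm n) →
    Nondegenerate B →
    (λ _ → fromℚ (+ 2 / n)) ∈ NewtonPolytope (toPolynomial B)
-- All weights are `1/n`: positive, of total `n/n = 1`, and with double `2/n`, the common coordinate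
-- of the target point.
theorem1 (suc d) B det#0 = average∈NewtonPolytope B det#0 (+ 1 / suc d) (+ 2 / suc d)
  (ℚ.<⇒≤ (ℚ.positive⁻¹ (+ 1 / suc d) {{ℚ.normalize-pos 1 (suc d)}}))
  (trans (∑-replicate-1/ (suc d) d) (n/n≡1 d))
  (sym (/-distribʳ-+ 1 1 d))
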